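{- Let $A$ and $I$ be finite sets with $|A|\geq 2$, and let $\mathrm{NC}_I\subseteq A^I$ be the set of non-constant sequences. A simplicial complex over $I$ generates $\mathrm{NC}_I$ if and only if it is connected. In other words, the minimal complexes generating $\mathrm{NC}_I$ are the trees spanning $I$.
   Context: All sets are finite. For $f:B^J\to A^I$ write $f_i(x)=f(x)_i$. For $i\in I$, the input window $\mathcal{W}_f(i)$ is the smallest set $W\subseteq J$ (it exists) such that for all $x,y\in B^J$, $x|_W=y|_W$ implies $f_i(x)=f_i(y)$. A simplicial complex (or complex) over a set $I$ is a collection of subsets of $I$, called its simplices, that is closed under taking subsets. The communication complex $K_f$ of $f$ is the complex over $I$ defined, for $S\subseteq I$, by: $S\in K_f$ iff $\bigcap_{i\in S}\mathcal{W}_f(i)\neq\emptyset$ (for $S=\emptyset$ the intersection is $J$). A complex $K$ over $I$ generates a language $L\subseteq A^I$ if there exist finite sets $B,J$ and a function $f:B^J\to A^I$ with image exactly $L$ and $K_f\subseteq K$. A complex generating $L$ is minimal if no complex strictly contained in it generates $L$. A complex over $I$ is disconnected if there is a partition $I=I_0\sqcup I_1$ into two non-empty sets such that every simplex is contained in $I_0$ or in $I_1$; otherwise it is connected. A tree spanning $I$ is a tree with vertex set $I$, regarded as a complex whose simplices are its vertices and edges (and the empty set).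
   Formalization: Degenerate cases where the claim fails are excluded: in the first part, the void complex (not containing the empty set) when |I| ≤ 1; in the second part, |I| = 1, where the complex {∅} already generates the empty language NC_I, so the one-vertex tree is not minimal. -}

module Defs where

open import Level using (0ℓ)
open import Data.Nat.Base using (ℕ; zero; suc; _≤_)
open import Data.Fin.Base using (Fin; zero; suc)
open import Data.Fin.Properties using (any?; all?; _≟_)
open import Data.Fin.Subset
  using (Subset; _∈_; _∉_; _⊆_; _∩_; _∪_; ∁; ⁅_⁆; ⊤; ⊥; Nonempty)
open import Data.Fin.Subset.Properties
  using (_∈?_; ∈⊤; anySubset?; p∩q⊆p; p∩q⊆q; x∈p∩q⁺)
open import Data.List.Base using (List; []; _∷_; length; _++_; [_])
open import Data.List.Relation.Unary.Linked using (Linked)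
open import Data.List.Relation.Unary.Unique.Propositional using (Unique)
open import Data.Product.Base using (Σ; ∃; ∃-syntax; Σ-syntax; _×_; _,_; proj₁; proj₂)
open import Data.Sum.Base using (_⊎_)
open import Data.Vec.Base using (Vec; []; _∷_; lookup; tabulate)
open import Data.Vec.Properties using (lookup∘tabulate)
open import Function.Bundles using (_⇔_)
open import Relation.Binary.Construct.Closure.ReflexiveTransitive using (Star)
open import Relation.Binary.PropositionalEquality using (_≡_; refl; sym; trans)
open import Relation.Nullary.Decidable using (Dec; yes; no; map′; ¬?; decidable-stable; _×-dec_; _→-dec_)
open import Relation.Nullary.Negation using (¬_; contradiction)
open import Relation.Unary using (Pred; Decidable)

-- The finite sets A, I, B, J are Fin a, Fin n, Fin b, Fin m.  Vectors rather than
-- functions represent the elements of A^I and B^J, because function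
-- extensionality is not available.
infix 9 _^ˢ_
_^ˢ_ : ℕ → ℕ → Set
a ^ˢ n = Vec (Fin a) n

Language : ℕ → ℕ → Set₁
Language a n = Pred (a ^ˢ n) 0ℓ

Constant : ∀ {a n} → a ^ˢ n → Set
Constant {a} x = ∃[ c ] ∀ i → lookup x i ≡ c

NC : ∀ a n → Language a n
NC a n x = ¬ Constant x

AgreeOn : ∀ {b m} → Subset m → b ^ˢ m → b ^ˢ m → Set
AgreeOn W x y = ∀ j → j ∈ W → lookup x j ≡ lookup y j

Determines : ∀ {b m a n} → (b ^ˢ m → a ^ˢ n) → Fin n → Subset m → Set
Determines f i W = ∀ x y → AgreeOn W x y → lookup (f x) i ≡ lookup (f y) i

IsInputWindow : ∀ {b m a n} → (b ^ˢ m → a ^ˢ n) → Fin n → Subset m → Set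
IsInputWindow f i W = Determines f i W × (∀ V → Determines f i V → W ⊆ V)

-- Existence of the smallest determining set: the determining sets form a
-- decidable family that contains ⊤ and is closed under ∩.

allVec? : ∀ {b} m {P : Pred (b ^ˢ m) 0ℓ} → Decidable P → Dec (∀ x → P x)
allVec? zero    P? = map′ (λ { p [] → p }) (λ p → p []) (P? [])
allVec? (suc m) P? =
  map′ (λ { p (c ∷ x) → p c x }) (λ p c x → p (c ∷ x))
       (all? λ c → allVec? m λ x → P? (c ∷ x))

determines? : ∀ {b m a n} (f : b ^ˢ m → a ^ˢ n) i → Decidable (Determines f i)
determines? {m = m} f i W =
  allVec? m λ x → allVec? m λ y →
    (all? λ j → (j ∈? W) →-dec (lookup x j ≟ lookup y j))
    →-dec (lookup (f x) i ≟ lookup (f y) i)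

lookup-ext : ∀ {b m} (x y : b ^ˢ m) → (∀ j → lookup x j ≡ lookup y j) → x ≡ y
lookup-ext []      []      _ = refl
lookup-ext (c ∷ x) (d ∷ y) e with e zero | lookup-ext x y (λ j → e (suc j))
... | refl | refl = refl

determines-⊤ : ∀ {b m a n} (f : b ^ˢ m → a ^ˢ n) i → Determines f i ⊤
determines-⊤ f i x y e with lookup-ext x y (λ j → e j ∈⊤)
... | refl = refl

determines-∩ : ∀ {b m a n} (f : b ^ˢ m → a ^ˢ n) i {V W} →
               Determines f i V → Determines f i W → Determines f i (V ∩ W)
determines-∩ {b} {m} f i {V} {W} dV dW x y e =
  trans (dV x z x≈z) (dW z y z≈y)
  where
  pick : Fin m → Fin b
  pick j with j ∈? V
  ... | yes _ = lookup x j
  ... | no  _ = lookup y j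

  z : b ^ˢ m
  z = tabulate pick

  pick-V : ∀ j → j ∈ V → lookup x j ≡ pick j
  pick-V j j∈V with j ∈? V
  ... | yes _   = refl
  ... | no  j∉V = contradiction j∈V j∉V

  pick-W : ∀ j → j ∈ W → pick j ≡ lookup y j
  pick-W j j∈W with j ∈? V
  ... | yes j∈V = e j (x∈p∩q⁺ (j∈V , j∈W))
  ... | no  _   = refl

  x≈z : AgreeOn V x z
  x≈z j j∈V = trans (pick-V j j∈V) (sym (lookup∘tabulate pick j))

  z≈y : AgreeOn W z y
  z≈y j j∈W = trans (lookup∘tabulate pick j) (pick-W j j∈W)

least : ∀ {m} {P : Pred (Subset m) 0ℓ} → Decidable P → P ⊤ →
        (∀ {V W} → P V → P W → P (V ∩ W)) →
        ∃[ W ] (P W × (∀ V → P V → W ⊆ V))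
least {m} {P} P? P⊤ P∩ =
  proj₁ all-j , proj₁ (proj₂ all-j) ,
  λ V PV {j} j∈W → decidable-stable (j ∈? V)
    (λ j∉V → proj₂ (proj₂ all-j) j V PV j∉V j∈W)
  where
  Excludes : Fin m → Subset m → Set
  Excludes j W = ∀ V → P V → j ∉ V → j ∉ W

  exclude : ∀ j → ∃[ W ] (P W × Excludes j W)
  exclude j with anySubset? (λ V → P? V ×-dec ¬? (j ∈? V))
  ... | yes (V , PV , j∉V) = V , PV , λ _ _ _ → j∉V
  ... | no  none           = ⊤ , P⊤ , λ V PV j∉V → contradiction (V , PV , j∉V) none

  meet : ∀ k (g : Fin k → Fin m) → ∃[ W ] (P W × (∀ l → Excludes (g l) W))
  meet zero    g = ⊤ , P⊤ , λ ()
  meet (suc k) g with exclude (g zero) | meet k (λ l → g (suc l))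
  ... | V , PV , exV | W , PW , exW = V ∩ W , P∩ PV PW , λ where
    zero    U PU ∉U ∈VW → exV   U PU ∉U (p∩q⊆p V W ∈VW)
    (suc l) U PU ∉U ∈VW → exW l U PU ∉U (p∩q⊆q V W ∈VW)

  all-j : ∃[ W ] (P W × (∀ j → Excludes j W))
  all-j = meet m (λ j → j)

inputWindow : ∀ {b m a n} (f : b ^ˢ m → a ^ˢ n) i → ∃[ W ] IsInputWindow f i W
inputWindow f i = least (determines? f i) (determines-⊤ f i) (determines-∩ f i)

𝒲 : ∀ {b m a n} → (b ^ˢ m → a ^ˢ n) → Fin n → Subset m
𝒲 f i = proj₁ (inputWindow f i)

-- Decidability expresses that a complex is a (finite) set of subsets.  Neither the
-- empty subset nor the singletons are required to be simplices.
record Complex (n : ℕ) : Set₁ where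
  field
    Simplex  : Pred (Subset n) 0ℓ
    simplex? : Decidable Simplex
    closed   : ∀ {S T} → S ⊆ T → Simplex T → Simplex S

open Complex public

infix 4 _⊑_ _⊏_
_⊑_ : ∀ {n} → Complex n → Complex n → Set
K ⊑ L = ∀ S → Simplex K S → Simplex L S

_⊏_ : ∀ {n} → Complex n → Complex n → Set
K ⊏ L = K ⊑ L × ¬ (L ⊑ K)

-- For S = ⊥ the condition says that J is non-empty.
communicationComplex : ∀ {b m a n} → (b ^ˢ m → a ^ˢ n) → Complex n
communicationComplex f = record
  { Simplex  = λ S → ∃[ j ] ∀ i → i ∈ S → j ∈ 𝒲 f i
  ; simplex? = λ S → any? λ j → all? λ i → (i ∈? S) →-dec (j ∈? 𝒲 f i)
  ; closed   = λ { S⊆T (j , h) → j , λ i i∈S → h i (S⊆T i∈S) }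
  }

HasImage : ∀ {b m a n} → (b ^ˢ m → a ^ˢ n) → Language a n → Set
HasImage f L = ∀ y → L y ⇔ (∃[ x ] f x ≡ y)

Generates : ∀ {a n} → Complex n → Language a n → Set
Generates {a} {n} K L =
  ∃[ b ] ∃[ m ] Σ[ f ∈ (b ^ˢ m → a ^ˢ n) ] (HasImage f L × communicationComplex f ⊑ K)

IsMinimalGenerating : ∀ {a n} → Complex n → Language a n → Set₁
IsMinimalGenerating K L = Generates K L × (∀ K′ → K′ ⊏ K → ¬ Generates K′ L)

Disconnected : ∀ {n} → Complex n → Set
Disconnected K =
  ∃[ I₀ ] (Nonempty I₀ × Nonempty (∁ I₀) × (∀ S → Simplex K S → S ⊆ I₀ ⊎ S ⊆ ∁ I₀))

Connected : ∀ {n} → Complex n → Set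
Connected K = ¬ Disconnected K

record Graph (n : ℕ) : Set₁ where
  field
    Adj    : Fin n → Fin n → Set
    symm   : ∀ {u v} → Adj u v → Adj v u
    irrefl : ∀ {v} → ¬ Adj v v

open Graph public

-- The list v ∷ vs of distinct vertices is the cycle; its length is at least 3.
HasCycle : ∀ {n} → Graph n → Set
HasCycle G =
  ∃[ v ] ∃[ vs ] (2 ≤ length vs × Unique (v ∷ vs) × Linked (Adj G) (v ∷ vs ++ [ v ]))

IsTree : ∀ {n} → Graph n → Set
IsTree G = (∀ u v → Star (Adj G) u v) × ¬ HasCycle G

IsVertexOrEdge : ∀ {n} → Graph n → Subset n → Set
IsVertexOrEdge G S =
  (∃[ v ] S ≡ ⁅ v ⁆) ⊎ (∃[ u ] ∃[ v ] (Adj G u v × S ≡ ⁅ u ⁆ ∪ ⁅ v ⁆))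

IsSpanningTree : ∀ {n} → Complex n → Set₁
IsSpanningTree {n} K =
  Σ[ G ∈ Graph n ] (IsTree G × (∀ S → Simplex K S ⇔ (S ≡ ⊥ ⊎ IsVertexOrEdge G S)))

{-# OPTIONS --safe #-}
module Submission where

-- Root a spanning tree of the connected complex and let every edge carry a free
-- label: an orientation and a value for each of its ends.  A vertex whose parent
-- edge points up outputs its own value on that edge; otherwise, if some child
-- edge points down, it outputs the parent value of that edge; otherwise it is a
-- sink, and outputs its own value on its parent edge unless that equals the
-- parent value, which it avoids (a root avoids the value of one fixed child).
-- For a tree, minimality holds because a spanning tree of a subcomplex that
-- misses an edge of the tree would close a cycle with that edge.  Conversely, in a
-- rooted tree a simple path that has turned away from the root keeps descending,
-- so the ends of a simple path with at least two edges are not adjacent.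

open import Defs
open import Data.Nat.Base as ℕ using (ℕ; zero; suc; _≤_; _<_; z≤n; s≤s)
open import Data.Nat.Properties as ℕ
  using (≤-refl; ≤-trans; <-trans; <-irrefl; <-asym; <⇒≤; <⇒≱)
open import Data.Nat.Induction using (<-wellFounded)
open import Data.Bool.Base using (if_then_else_)
open import Data.Fin.Base using (Fin; zero; suc; combine; remQuot)
open import Data.Fin.Induction using (spo-noetherian)
open import Data.Fin.Properties using (any?; _≟_; remQuot-combine)
open import Data.Fin.Subset
  using (Subset; _∈_; _∉_; _⊆_; _⊃_; _∪_; ∁; ⁅_⁆; ⊥; Nonempty)
open import Data.Fin.Subset.Properties
open import Data.Fin.Subset.Induction using (⊃-wellFounded)
open import Data.List.Base using (List; []; _∷_; length; _++_; [_])
open import Data.List.Membership.Propositional using () renaming (_∈_ to _∈ˡ_)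
open import Data.List.Relation.Unary.All as All using ([]; _∷_)
open import Data.List.Relation.Unary.All.Properties using (¬Any⇒All¬)
open import Data.List.Relation.Unary.AllPairs using ([]; _∷_)
open import Data.List.Relation.Unary.Any as Any using (here; there)
open import Data.List.Relation.Unary.Linked using (Linked; [-]; _∷_)
open import Data.List.Relation.Unary.Unique.Propositional using (Unique)
open import Data.Product.Base using (∃-syntax; _×_; _,_; proj₁; proj₂; map₂)
open import Data.Sum.Base using (_⊎_; inj₁; inj₂; swap)
open import Data.Vec.Base using ([]; _∷_; lookup; tabulate)
open import Data.Vec.Properties
  using (lookup∘tabulate; tabulate-cong; lookup⇒[]=; []=⇒lookup)
open import Function.Base using (_∘_; _on_; flip)
open import Function.Bundles using (_⇔_; mk⇔; Equivalence)
open import Induction.WellFounded using (Acc; acc)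
import Relation.Binary.Construct.On as On
open import Relation.Binary.Construct.Closure.ReflexiveTransitive
  using (Star; ε; _◅_; _◅◅_)
open import Relation.Binary.PropositionalEquality
  using (_≡_; _≢_; refl; sym; trans; cong; subst; ≢-sym)
open import Relation.Nullary.Decidable
  using (Dec; yes; no; does; ¬?; decidable-stable; _×-dec_; _⊎-dec_;
         dec-true; dec-false)
open import Relation.Nullary.Negation using (¬_; contradiction)
open import Relation.Unary using (Decidable)

-- Subsets cut out by decidable predicates, and pairs of vertices

module _ {n} {P : Fin n → Set} (P? : Decidable P) where

  ⟦_⟧ : Subset n
  ⟦_⟧ = tabulate (does ∘ P?)

  ∈⟦⟧⁺ : ∀ {i} → P i → i ∈ ⟦_⟧
  ∈⟦⟧⁺ {i} p =
    lookup⇒[]= i ⟦_⟧ (trans (lookup∘tabulate (does ∘ P?) i) (dec-true (P? i) p))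

  ∈⟦⟧⁻ : ∀ {i} → i ∈ ⟦_⟧ → P i
  ∈⟦⟧⁻ {i} i∈ with P? i | trans (sym (lookup∘tabulate (does ∘ P?) i)) ([]=⇒lookup i∈)
  ... | yes p | _ = p
  ... | no  _ | ()

module _ {n} {u v : Fin n} where

  u∈⁅u⁆∪⁅v⁆ : u ∈ ⁅ u ⁆ ∪ ⁅ v ⁆
  u∈⁅u⁆∪⁅v⁆ = x∈p∪q⁺ (inj₁ (x∈⁅x⁆ u))

  v∈⁅u⁆∪⁅v⁆ : v ∈ ⁅ u ⁆ ∪ ⁅ v ⁆
  v∈⁅u⁆∪⁅v⁆ = x∈p∪q⁺ (inj₂ (x∈⁅x⁆ v))

  ∈⁅u⁆∪⁅v⁆⁻ : ∀ {w} → w ∈ ⁅ u ⁆ ∪ ⁅ v ⁆ → w ≡ u ⊎ w ≡ v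
  ∈⁅u⁆∪⁅v⁆⁻ w∈ with x∈p∪q⁻ ⁅ u ⁆ ⁅ v ⁆ w∈
  ... | inj₁ w∈u = inj₁ (x∈⁅y⁆⇒x≡y u w∈u)
  ... | inj₂ w∈v = inj₂ (x∈⁅y⁆⇒x≡y v w∈v)

  ⁅u⁆∪⁅v⁆⊆ : ∀ {S} → u ∈ S → v ∈ S → ⁅ u ⁆ ∪ ⁅ v ⁆ ⊆ S
  ⁅u⁆∪⁅v⁆⊆ u∈S v∈S w∈ with ∈⁅u⁆∪⁅v⁆⁻ w∈
  ... | inj₁ refl = u∈S
  ... | inj₂ refl = v∈S

⁅u⁆⊆ : ∀ {n} {u : Fin n} {S} → u ∈ S → ⁅ u ⁆ ⊆ S
⁅u⁆⊆ {u = u} u∈S w∈ with refl ← x∈⁅y⁆⇒x≡y u w∈ = u∈S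

-- Rooted spanning trees

-- The root is its own parent, so `edge root` makes its singleton a simplex. `rank` need not be the
-- depth: induction uses only its strict decrease towards the root.
record RootedTree {n} (K : Complex n) : Set where
  field
    root        : Fin n
    parent      : Fin n → Fin n
    rank        : Fin n → ℕ
    parent-root : parent root ≡ root
    rank-parent : ∀ {v} → v ≢ root → rank (parent v) < rank v
    edge        : ∀ v → Simplex K (⁅ v ⁆ ∪ ⁅ parent v ⁆)

  Child : Fin n → Fin n → Set
  Child v w = w ≢ root × parent w ≡ v

  child? : ∀ v w → Dec (Child v w)
  child? v w = ¬? (w ≟ root) ×-dec (parent w ≟ v)

  rank-child : ∀ {v w} → Child v w → rank v < rank w
  rank-child (w≢root , refl) = rank-parent w≢root

  Adjacent : Fin n → Fin n → Set
  Adjacent u v = Child u v ⊎ Child v u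

  adjacent? : ∀ u v → Dec (Adjacent u v)
  adjacent? u v = child? u v ⊎-dec child? v u

  adjacent-irrefl : ∀ {v} → ¬ Adjacent v v
  adjacent-irrefl (inj₁ c) = <-irrefl refl (rank-child c)
  adjacent-irrefl (inj₂ c) = <-irrefl refl (rank-child c)

  adjacent-simplex : ∀ {u v} → Adjacent u v → Simplex K (⁅ u ⁆ ∪ ⁅ v ⁆)
  adjacent-simplex {v = v} (inj₁ (_ , refl)) =
    closed K (⁅u⁆∪⁅v⁆⊆ v∈⁅u⁆∪⁅v⁆ u∈⁅u⁆∪⁅v⁆) (edge v)
  adjacent-simplex {u} (inj₂ (_ , refl)) = edge u

  module _ (P : Fin n → Set) (P-root : P root)
           (P-child : ∀ {v w} → Child v w → P v → P w) where

    tree-induction : ∀ v → P v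
    tree-induction v = go v (<-wellFounded (rank v))
      where
      go : ∀ v → Acc _<_ (rank v) → P v
      go v (acc rec) with v ≟ root
      ... | yes refl   = P-root
      ... | no  v≢root =
        P-child (v≢root , refl) (go (parent v) (rec (rank-parent v≢root)))

  star-to-root : ∀ v → Star Adjacent v root
  star-to-root = tree-induction _ ε (λ c s → inj₂ c ◅ s)

  star-from-root : ∀ v → Star Adjacent root v
  star-from-root = tree-induction _ ε (λ c s → s ◅◅ (inj₁ c ◅ ε))

  -- Ranks increase strictly from parent to child, and there are finitely many vertices.
  no-infinite-descent : ∀ (P : Fin n → Set) → P root →
                        ¬ (∀ {v} → P v → ∃[ w ] (Child v w × P w))
  no-infinite-descent P P-root next = go (noetherian root) P-root
    where
    noetherian = spo-noetherian (On.isStrictPartialOrder rank ℕ.<-isStrictPartialOrder)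

    go : ∀ {v} → Acc (flip (_<_ on rank)) v → ¬ P v
    go (acc rec) p with next p
    ... | w , c , q = go (rec (rank-child c)) q

-- Existence of a rooted spanning tree

-- Otherwise `S` itself would disconnect `K`: by closure, a simplex meeting both sides contains a
-- crossing pair.
crossing-edge : ∀ {n} (K : Complex n) → Connected K → ∀ {S} → Nonempty S → Nonempty (∁ S) →
                ∃[ v ] ∃[ w ] (v ∈ S × w ∉ S × Simplex K (⁅ v ⁆ ∪ ⁅ w ⁆))
crossing-edge {n} K conn {S} S≠⊥ ∁S≠⊥
  with any? (λ v → any? λ w → (v ∈? S) ×-dec ¬? (w ∈? S) ×-dec simplex? K (⁅ v ⁆ ∪ ⁅ w ⁆))
... | yes crossing = crossing
... | no  none     = contradiction (S , S≠⊥ , ∁S≠⊥ , split) conn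
  where
  split : ∀ R → Simplex K R → R ⊆ S ⊎ R ⊆ ∁ S
  split R K-R with any? (λ v → (v ∈? R) ×-dec (v ∈? S))
  ... | no  disjoint        = inj₂ λ w∈R → x∉p⇒x∈∁p λ w∈S → disjoint (_ , w∈R , w∈S)
  ... | yes (v , v∈R , v∈S) = inj₁ λ {w} w∈R → decidable-stable (w ∈? S)
    λ w∉S → none (v , w , v∈S , w∉S , closed K (⁅u⁆∪⁅v⁆⊆ v∈R w∈R) K-R)

module _ {n} (K : Complex n) (conn : Connected K) (r : Fin n) where

  -- `parent` and `rank` are total, but constrained only on the vertices reached so far.
  record PartialTree (S : Subset n) : Set where
    field
      parent      : Fin n → Fin n
      rank        : Fin n → ℕ
      root∈       : r ∈ S
      parent-root : parent r ≡ r
      parent∈     : ∀ {v} → v ∈ S → parent v ∈ S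
      rank-parent : ∀ {v} → v ∈ S → v ≢ r → rank (parent v) < rank v
      edge        : ∀ {v} → v ∈ S → Simplex K (⁅ v ⁆ ∪ ⁅ parent v ⁆)

  singleton : Simplex K ⁅ r ⁆ → PartialTree ⁅ r ⁆
  singleton K-r = record
    { parent      = λ _ → r
    ; rank        = λ _ → 0
    ; root∈       = x∈⁅x⁆ r
    ; parent-root = refl
    ; parent∈     = λ _ → x∈⁅x⁆ r
    ; rank-parent = λ v∈ v≢r → contradiction (x∈⁅y⁆⇒x≡y r v∈) v≢r
    ; edge        = λ v∈ → closed K (⁅u⁆∪⁅v⁆⊆ v∈ (x∈⁅x⁆ r)) K-r
    }

  module _ {S} (T : PartialTree S) {v w} (v∈S : v ∈ S) (w∉S : w ∉ S)
           (K-vw : Simplex K (⁅ v ⁆ ∪ ⁅ w ⁆)) where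
    open PartialTree T

    private
      parent′ : Fin n → Fin n
      parent′ x with x ≟ w
      ... | yes _ = v
      ... | no  _ = parent x

      rank′ : Fin n → ℕ
      rank′ x with x ≟ w
      ... | yes _ = suc (rank v)
      ... | no  _ = rank x

      rank′-old : ∀ {x} → x ∈ S → rank′ x ≡ rank x
      rank′-old {x} x∈S with x ≟ w
      ... | yes refl = contradiction x∈S w∉S
      ... | no  _    = refl

      old : ∀ {x} → x ∈ S ∪ ⁅ w ⁆ → x ≢ w → x ∈ S
      old x∈ x≢w with x∈p∪q⁻ S ⁅ w ⁆ x∈
      ... | inj₁ x∈S = x∈S
      ... | inj₂ x∈w = contradiction (x∈⁅y⁆⇒x≡y w x∈w) x≢w

      parent-root′ : parent′ r ≡ r
      parent-root′ with r ≟ w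
      ... | yes refl = contradiction root∈ w∉S
      ... | no  _    = parent-root

      parent∈′ : ∀ {x} → x ∈ S ∪ ⁅ w ⁆ → parent′ x ∈ S ∪ ⁅ w ⁆
      parent∈′ {x} x∈ with x ≟ w
      ... | yes _   = p⊆p∪q ⁅ w ⁆ v∈S
      ... | no  x≢w = p⊆p∪q ⁅ w ⁆ (parent∈ (old x∈ x≢w))

      rank-parent′ : ∀ {x} → x ∈ S ∪ ⁅ w ⁆ → x ≢ r → rank′ (parent′ x) < rank′ x
      rank-parent′ {x} x∈ x≢r with x ≟ w
      ... | yes _   rewrite rank′-old v∈S = ≤-refl
      ... | no  x≢w rewrite rank′-old (parent∈ (old x∈ x≢w)) = rank-parent (old x∈ x≢w) x≢r

      edge′ : ∀ {x} → x ∈ S ∪ ⁅ w ⁆ → Simplex K (⁅ x ⁆ ∪ ⁅ parent′ x ⁆)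
      edge′ {x} x∈ with x ≟ w
      ... | yes refl = closed K (⁅u⁆∪⁅v⁆⊆ v∈⁅u⁆∪⁅v⁆ u∈⁅u⁆∪⁅v⁆) K-vw
      ... | no  x≢w  = edge (old x∈ x≢w)

    attach : PartialTree (S ∪ ⁅ w ⁆)
    attach = record
      { parent = parent′ ; rank = rank′ ; root∈ = p⊆p∪q ⁅ w ⁆ root∈
      ; parent-root = parent-root′ ; parent∈ = parent∈′
      ; rank-parent = rank-parent′ ; edge = edge′ }

  grow : ∀ {S} → Acc _⊃_ S → PartialTree S → RootedTree K
  grow {S} (acc rec) T with nonempty? (∁ S)
  ... | no  full = record
    { root = r ; parent = parent ; rank = rank ; parent-root = parent-root
    ; rank-parent = rank-parent all∈ ; edge = λ _ → edge all∈ }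
    where
    open PartialTree T
    all∈ : ∀ {v} → v ∈ S
    all∈ = x∉∁p⇒x∈p (λ v∈∁S → full (_ , v∈∁S))
  ... | yes ∁S≠⊥ with crossing-edge K conn (r , PartialTree.root∈ T) ∁S≠⊥
  ... | v , w , v∈S , w∉S , K-vw =
    grow (rec (p⊆p∪q ⁅ w ⁆ , w , q⊆p∪q S ⁅ w ⁆ (x∈⁅x⁆ w) , w∉S)) (attach T v∈S w∉S K-vw)

rootedTree : ∀ {n} (K : Complex (2 ℕ.+ n)) → Connected K → RootedTree K
rootedTree K conn
  -- Singletons need not be simplices; an edge leaving the root shows that the root's singleton is
  -- one.
  with crossing-edge K conn (zero , x∈⁅x⁆ zero)
         (suc zero , x∉p⇒x∈∁p (x≢y⇒x∉⁅y⁆ {x = suc zero} {zero} λ ()))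
... | v , w , v∈ , _ , K-vw with refl ← x∈⁅y⁆⇒x≡y zero v∈ =
  grow K conn zero (⊃-wellFounded _)
    (singleton K conn zero (closed K (⁅u⁆⊆ {u = zero} (u∈⁅u⁆∪⁅v⁆ {v = w})) K-vw))

-- Generating the non-constant sequences along a tree

other : ∀ {k} → Fin (2 ℕ.+ k) → Fin (2 ℕ.+ k)
other zero    = suc zero
other (suc _) = zero

other-≢ : ∀ {k} (c : Fin (2 ℕ.+ k)) → c ≢ other c
other-≢ zero    ()
other-≢ (suc _) ()

avoid : ∀ {k} → Fin (2 ℕ.+ k) → Fin (2 ℕ.+ k) → Fin (2 ℕ.+ k)
avoid t c with c ≟ t
... | yes _ = other t
... | no  _ = c

avoid-≢ : ∀ {k} (t c : Fin (2 ℕ.+ k)) → t ≢ avoid t c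
avoid-≢ t c with c ≟ t
... | yes _   = other-≢ t
... | no  c≢t = ≢-sym c≢t

avoid-≡ : ∀ {k} {t c : Fin (2 ℕ.+ k)} → c ≢ t → avoid t c ≡ c
avoid-≡ {t = t} {c} c≢t with c ≟ t
... | yes c≡t = contradiction c≡t c≢t
... | no  _   = refl

-- The label of the edge between w and parent w: its orientation, a value for
-- parent w (used if the edge points down) and a value for w.
Label : ℕ → Set
Label a = Fin 2 × Fin a × Fin a

pattern upward   = zero
pattern downward = suc zero

dir : ∀ {a} → Label a → Fin 2
dir (d , _ , _) = d

parentValue childValue : ∀ {a} → Label a → Fin a
parentValue (_ , p , _) = p
childValue  (_ , _ , c) = c

abstract

  labels : ℕ → ℕ
  labels a = 2 ℕ.* (a ℕ.* a)

  encode : ∀ {a} → Label a → Fin (labels a)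
  encode (d , p , c) = combine d (combine p c)

  decode : ∀ {a} → Fin (labels a) → Label a
  decode {a} e = map₂ (remQuot a) (remQuot {2} (a ℕ.* a) e)

  decode-encode : ∀ {a} (l : Label a) → decode (encode l) ≡ l
  decode-encode {a} (d , p , c) =
    trans (cong (map₂ (remQuot a)) (remQuot-combine d (combine p c)))
          (cong (d ,_) (remQuot-combine p c))

-- Masked inputs and bounds on windows

mask : ∀ {b m} → Fin b → Subset m → b ^ˢ m → b ^ˢ m
mask d W x = tabulate λ j → if does (j ∈? W) then lookup x j else d

mask-lookup : ∀ {b m} (d : Fin b) {W : Subset m} (x : b ^ˢ m) {j} → j ∈ W →
              lookup (mask d W x) j ≡ lookup x j
mask-lookup d {W} x {j} j∈W
  rewrite lookup∘tabulate (λ i → if does (i ∈? W) then lookup x i else d) j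
        | dec-true (j ∈? W) j∈W = refl

mask-cong : ∀ {b m} (d : Fin b) {W : Subset m} {x y : b ^ˢ m} → AgreeOn W x y →
            mask d W x ≡ mask d W y
mask-cong d {W} {x} {y} x≈y = tabulate-cong eq
  where
  eq : ∀ j → (if does (j ∈? W) then lookup x j else d)
           ≡ (if does (j ∈? W) then lookup y j else d)
  eq j with j ∈? W
  ... | yes j∈W = x≈y j j∈W
  ... | no  _   = refl

𝒲-⊆ : ∀ {b m a n} (f : b ^ˢ m → a ^ˢ n) {i V} → Determines f i V → 𝒲 f i ⊆ V
𝒲-⊆ f {i} = proj₂ (proj₂ (inputWindow f i)) _

𝒲-determines : ∀ {b m a n} (f : b ^ˢ m → a ^ˢ n) i → Determines f i (𝒲 f i)
𝒲-determines f i = proj₁ (proj₂ (inputWindow f i))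

mkGenerates : ∀ {b m a n} (f : b ^ˢ m → a ^ˢ n) {K : Complex n} {L : Language a n} →
              HasImage f L → communicationComplex f ⊑ K → Generates K L
mkGenerates f im sub = _ , _ , f , im , sub

-- Each window is contained in every determining set, so it suffices to bound the common elements of
-- the `W i`.
communicationComplex-⊑ : ∀ {b m a n} (f : b ^ˢ m → a ^ˢ n) (K : Complex n) (W : Fin n → Subset m) →
  (∀ i → Determines f i (W i)) → (∀ S j → (∀ i → i ∈ S → j ∈ W i) → Simplex K S) →
  communicationComplex f ⊑ K
communicationComplex-⊑ f K W det locality S (j , j∈𝒲) =
  locality S j λ i i∈S → 𝒲-⊆ f {i} {W i} (det i) {j} (j∈𝒲 i i∈S)

module _ {k n : ℕ} {K : Complex (2 ℕ.+ n)} (T : RootedTree K) where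
  open RootedTree T

  private
    N a : ℕ
    N = 2 ℕ.+ n
    a = 2 ℕ.+ k

  -- With at least two vertices some vertex is not the root; climbing from it, the last vertex
  -- before the root is the child sought.
  child-of-root : ∃[ w ] Child root w
  child-of-root = nonroot (root ≟ zero)
    where
    search : ∀ v → v ≢ root → ∃[ w ] Child root w
    search = tree-induction _ (λ r≢r → contradiction refl r≢r) step
      where
      step : ∀ {v w} → Child v w → (v ≢ root → ∃[ w ] Child root w) →
             w ≢ root → ∃[ w ] Child root w
      step {v} {w} c ih _ with v ≟ root
      ... | yes refl   = w , c
      ... | no  v≢root = ih v≢root

    nonroot : Dec (root ≡ zero) → ∃[ w ] Child root w
    nonroot (yes root≡0) = search (suc zero) λ 1≡root → contradiction (trans 1≡root root≡0) λ ()
    nonroot (no  root≢0) = search zero (≢-sym root≢0)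

  -- The root has no parent edge, so its sink rule refers to the label of the edge to this child.
  hub : Fin N
  hub = proj₁ child-of-root

  hub-child : Child root hub
  hub-child = proj₂ child-of-root

  -- A relation, so that `descend` may use any child edge pointing down and nothing depends on which
  -- one `output` finds. The first premise of `descend` is vacuous at the root.
  data Output (ℓ : Fin N → Label a) (v : Fin N) (o : Fin a) : Set where
    climb    : v ≢ root → dir (ℓ v) ≡ upward → o ≡ childValue (ℓ v) → Output ℓ v o
    descend  : ∀ {w} → (v ≢ root → dir (ℓ v) ≡ downward) →
               Child v w → dir (ℓ w) ≡ downward → o ≡ parentValue (ℓ w) → Output ℓ v o
    sink     : v ≢ root → dir (ℓ v) ≡ downward →
               (∀ {w} → Child v w → dir (ℓ w) ≢ downward) →
               o ≡ avoid (parentValue (ℓ v)) (childValue (ℓ v)) → Output ℓ v o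
    rootSink : v ≡ root → (∀ {w} → Child v w → dir (ℓ w) ≢ downward) →
               o ≡ other (childValue (ℓ hub)) → Output ℓ v o

  output : ∀ ℓ v → ∃[ o ] Output ℓ v o
  output ℓ v with v ≟ root | dir (ℓ v) in d
               | any? (λ w → child? v w ×-dec (dir (ℓ w) ≟ downward))
  ... | yes v≡r | _        | yes (w , c , e) = _ , descend (λ v≢r → contradiction v≡r v≢r) c e refl
  ... | yes v≡r | _        | no  none = _ , rootSink v≡r (λ c e → none (_ , c , e)) refl
  ... | no  v≢r | upward   | _ = _ , climb v≢r d refl
  ... | no  v≢r | downward | yes (w , c , e) = _ , descend (λ _ → d) c e refl
  ... | no  v≢r | downward | no  none = _ , sink v≢r d (λ c e → none (_ , c , e)) refl

  -- Labels are indexed by the lower end of their edge, so the edges at `v` are indexed by `v` and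
  -- its children.
  reads? : ∀ v j → Dec (j ≡ v ⊎ parent j ≡ v)
  reads? v j = (j ≟ v) ⊎-dec (parent j ≟ v)

  -- Every case consults only the labels of `v` and its children, `rootSink` included, since `hub`
  -- is a child of the root.
  output-local : ∀ {ℓ ℓ′ v o} → (∀ {j} → j ≡ v ⊎ parent j ≡ v → ℓ j ≡ ℓ′ j) →
                 Output ℓ v o → Output ℓ′ v o
  output-local {ℓ} {ℓ′} {v} e = λ where
      (climb v≢r d o≡)   → climb v≢r (trans (own dir) d) (trans o≡ (sym (own childValue)))
      (descend d c d′ o≡) → descend (trans (own dir) ∘ d) c (trans (below dir c) d′)
                              (trans o≡ (sym (below parentValue c)))
      (sink v≢r d none o≡) →
        sink v≢r (trans (own dir) d) (λ c → none c ∘ trans (sym (below dir c)))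
          (trans o≡ (sym (own (λ l → avoid (parentValue l) (childValue l)))))
      (rootSink refl none o≡) →
        rootSink refl (λ c → none c ∘ trans (sym (below dir c)))
          (trans o≡ (sym (below (other ∘ childValue) hub-child)))
    where
    own : ∀ {X : Set} (g : Label a → X) → g (ℓ′ v) ≡ g (ℓ v)
    own g = cong g (sym (e (inj₁ refl)))

    below : ∀ {X : Set} (g : Label a → X) {w} → Child v w → g (ℓ′ w) ≡ g (ℓ w)
    below g c = cong g (sym (e (inj₂ (proj₂ c))))

  -- If all outputs were c, then from the root one could descend forever along
  -- edges that point down and carry the parent value c: a sink differs from the
  -- parent value of its edge.
  output-nonconstant : ∀ {ℓ c} → ¬ (∀ v → Output ℓ v c)
  output-nonconstant {ℓ} {c} out = no-infinite-descent Live (inj₁ refl) next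
    where
    Live : Fin N → Set
    Live v = v ≡ root ⊎ (v ≢ root × dir (ℓ v) ≡ downward × parentValue (ℓ v) ≡ c)

    -- At a root sink the hub edge points up, so the hub outputs its own value. If that is `c`, the
    -- root outputs `other c`, not `c`.
    hub-value : dir (ℓ hub) ≢ downward → c ≡ childValue (ℓ hub)
    hub-value up with out hub
    ... | climb _ _ c≡      = c≡
    ... | descend d _ _ _   = contradiction (d (proj₁ hub-child)) up
    ... | sink _ d _ _      = contradiction d up
    ... | rootSink h≡r _ _  = contradiction h≡r (proj₁ hub-child)

    next : ∀ {v} → Live v → ∃[ w ] (Child v w × Live w)
    next {v} live with out v | live
    ... | descend _ ch d c≡ | _                  = _ , ch , inj₂ (proj₁ ch , d , sym c≡)
    ... | climb v≢r _ _     | inj₁ v≡r           = contradiction v≡r v≢r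
    ... | climb _ up _      | inj₂ (_ , d , _)   = contradiction (trans (sym up) d) λ ()
    ... | sink v≢r _ _ _    | inj₁ v≡r           = contradiction v≡r v≢r
    ... | sink _ _ _ c≡     | inj₂ (_ , _ , refl) = contradiction c≡ (avoid-≢ _ (childValue (ℓ v)))
    ... | rootSink v≡r _ _  | inj₂ (v≢r , _)     = contradiction v≡r v≢r
    ... | rootSink refl none c≡ | inj₁ _         =
      contradiction (trans c≡ (cong other (sym (hub-value (none hub-child))))) (other-≢ c)

  -- `D` is the vertex set of the path from the root to `v`, built by appending one child at a time.
  route : ∀ v → ∃[ D ] (v ∈ D × root ∈ D ×
            (∀ {w} → w ∈ D → w ≡ v ⊎ ∃[ w′ ] (w′ ∈ D × Child w w′)))
  route = tree-induction _
    (⁅ root ⁆ , x∈⁅x⁆ root , x∈⁅x⁆ root , inj₁ ∘ x∈⁅y⁆⇒x≡y root) step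
    where
    step : ∀ {v w} → Child v w → _ → _
    step {v} {w} c (D , v∈D , r∈D , next) =
      D ∪ ⁅ w ⁆ , q⊆p∪q D ⁅ w ⁆ (x∈⁅x⁆ w) , p⊆p∪q ⁅ w ⁆ r∈D , next′
      where
      next′ : ∀ {u} → u ∈ D ∪ ⁅ w ⁆ → u ≡ w ⊎ ∃[ u′ ] (u′ ∈ D ∪ ⁅ w ⁆ × Child u u′)
      next′ u∈ with x∈p∪q⁻ D ⁅ w ⁆ u∈
      ... | inj₂ u∈w = inj₁ (x∈⁅y⁆⇒x≡y w u∈w)
      ... | inj₁ u∈D with next u∈D
      ...   | inj₁ refl              = inj₂ (w , q⊆p∪q D ⁅ w ⁆ (x∈⁅x⁆ w) , c)
      ...   | inj₂ (u′ , u′∈D , c′) = inj₂ (u′ , p⊆p∪q ⁅ w ⁆ u′∈D , c′)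

  -- If every vertex agreed with its parent, the value at the root would spread over the whole tree.
  discontinuity : ∀ (y : a ^ˢ N) → ¬ Constant y →
                  ∃[ v ] (v ≢ root × lookup y v ≢ lookup y (parent v))
  discontinuity y ¬const
    with any? (λ v → ¬? (v ≟ root) ×-dec ¬? (lookup y v ≟ lookup y (parent v)))
  ... | yes found = found
  ... | no  none  = contradiction (lookup y root , tree-induction _ refl step) ¬const
    where
    step : ∀ {v w} → Child v w → lookup y v ≡ lookup y root → lookup y w ≡ lookup y root
    step {w = w} (w≢r , refl) y≡ =
      trans (decidable-stable (_ ≟ _) λ y≢ → none (w , w≢r , y≢)) y≡

  -- All edges are oriented towards v, whose value differs from that of its parent.
  output-realises : ∀ (y : a ^ˢ N) → ¬ Constant y →
                    ∃[ ℓ ] (∀ u o → Output ℓ u o → o ≡ lookup y u)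
  output-realises y ¬const with discontinuity y ¬const
  ... | v , v≢r , y≢ with route v
  ... | D , v∈D , r∈D , next = ℓ , realises
    where
    -- Edges on the path from the root to `v` point down and all others up, hence all towards `v`.
    direction : Fin N → Fin 2
    direction w = if does (w ∈? D) then downward else upward

    ∈⇒downward : ∀ {w} → w ∈ D → direction w ≡ downward
    ∈⇒downward {w} w∈D rewrite dec-true (w ∈? D) w∈D = refl

    downward⇒∈ : ∀ {w} → direction w ≡ downward → w ∈ D
    downward⇒∈ {w} d with w ∈? D
    ... | yes w∈D = w∈D

    ℓ : Fin N → Label a
    ℓ w = direction w , lookup y (parent w) , lookup y w

    realises : ∀ u o → Output ℓ u o → o ≡ lookup y u
    realises u o (climb _ _ o≡)               = o≡
    realises u o (descend _ (_ , refl) _ o≡)  = o≡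
    realises u o (sink _ d none o≡) with next {u} (downward⇒∈ d)
    -- Only `v` can be a sink, and there `avoid` changes nothing, by the choice of `v`.
    ... | inj₁ refl              = trans o≡ (avoid-≡ {t = lookup y (parent u)} y≢)
    ... | inj₂ (u′ , u′∈D , c) = contradiction (∈⇒downward u′∈D) (none c)
    realises u o (rootSink refl none o≡) with next {root} r∈D
    ... | inj₁ r≡v               = contradiction (sym r≡v) v≢r
    ... | inj₂ (u′ , u′∈D , c) = contradiction (∈⇒downward u′∈D) (none c)

  -- The generating function and its communication complex

  abstract

    -- Since the response is computed from the masked input, its dependence on `⟦ reads? v ⟧` alone
    -- follows by congruence, whichever child `output` selects.
    visible : Fin N → labels a ^ˢ N → labels a ^ˢ N
    visible v = mask (encode {a} (upward , zero , zero)) ⟦ reads? v ⟧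

    visible-lookup : ∀ v x {j} → j ≡ v ⊎ parent j ≡ v → lookup (visible v x) j ≡ lookup x j
    visible-lookup v x r = mask-lookup _ x (∈⟦⟧⁺ (reads? v) r)

    visible-cong : ∀ v {x y} → AgreeOn ⟦ reads? v ⟧ x y → visible v x ≡ visible v y
    visible-cong v {x} {y} x≈y = mask-cong _ {⟦ reads? v ⟧} {x} {y} x≈y

    respond : Fin N → labels a ^ˢ N → Fin a
    respond v z = proj₁ (output (decode ∘ lookup z) v)

    respond-output : ∀ v z → Output (decode ∘ lookup z) v (respond v z)
    respond-output v z = proj₂ (output (decode ∘ lookup z) v)

  generate : labels a ^ˢ N → a ^ˢ N
  generate x = tabulate λ v → respond v (visible v x)

  lookup-generate : ∀ x v → lookup (generate x) v ≡ respond v (visible v x)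
  lookup-generate x v = lookup∘tabulate (λ v → respond v (visible v x)) v

  generate-output : ∀ x v → Output (decode ∘ lookup x) v (lookup (generate x) v)
  generate-output x v =
    subst (Output (decode ∘ lookup x) v) (sym (lookup-generate x v))
      (output-local (λ r → cong decode (visible-lookup v x r)) (respond-output v (visible v x)))

  generate-determined : ∀ v → Determines generate v ⟦ reads? v ⟧
  generate-determined v x y x≈y =
    trans (lookup-generate x v)
      (trans (cong (respond v) (visible-cong v {x} {y} x≈y)) (sym (lookup-generate y v)))

  generate-image : HasImage generate (NC a N)
  generate-image y = mk⇔ to from
    where
    to : NC a N y → ∃[ x ] generate x ≡ y
    to ¬const with output-realises y ¬const
    ... | ℓ , realises = x , lookup-ext _ y λ v →
      realises v _ (output-local (λ {j} _ → decoded j) (generate-output x v))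
      where
      x = tabulate (encode ∘ ℓ)
      decoded : ∀ j → decode (lookup x j) ≡ ℓ j
      decoded j = trans (cong decode (lookup∘tabulate (encode ∘ ℓ) j)) (decode-encode (ℓ j))

    from : ∃[ x ] generate x ≡ y → NC a N y
    from (x , refl) (c , const) =
      output-nonconstant λ v → subst (Output (decode ∘ lookup x) v) (const v) (generate-output x v)

  incident : ∀ {v j} → j ∈ ⟦ reads? v ⟧ → v ∈ ⁅ j ⁆ ∪ ⁅ parent j ⁆
  incident {v} {j} j∈ with ∈⟦⟧⁻ (reads? v) {j} j∈
  ... | inj₁ refl = u∈⁅u⁆∪⁅v⁆
  ... | inj₂ refl = v∈⁅u⁆∪⁅v⁆

  -- All readers of input `j` are ends of the edge from `j` to its parent, which is a simplex of
  -- `K`.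
  locality : ∀ S j → (∀ v → v ∈ S → j ∈ ⟦ reads? v ⟧) → Simplex K S
  locality S j j∈ = closed K {S} {⁅ j ⁆ ∪ ⁅ parent j ⁆}
    (λ {v} v∈S → incident {v} {j} (j∈ v v∈S)) (edge j)

  generate-complex : communicationComplex generate ⊑ K
  generate-complex =
    communicationComplex-⊑ generate K (λ v → ⟦ reads? v ⟧) generate-determined locality

  tree-generates : Generates K (NC a N)
  tree-generates = mkGenerates generate {K} {NC a N} generate-image generate-complex

-- Generating and connectedness

generates-empty : ∀ {a n} (K : Complex n) (L : Language a n) → (∀ y → ¬ L y) → Simplex K ⊥ →
                  Generates K L
generates-empty {a} {n} K L L-empty K-⊥ = mkGenerates f {K} {L} image
  (communicationComplex-⊑ f K (λ _ → ⊥) (λ { _ (() ∷ _) })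
    λ S _ none → closed K (λ {i} i∈S → contradiction (none i i∈S) ∉⊥) K-⊥)
  where
  -- An empty domain needs an empty alphabet and at least one input. All windows are empty, but as J
  -- is non-empty the empty set is a simplex of the communication complex.
  f : 0 ^ˢ 1 → a ^ˢ n
  f (() ∷ _)

  image : HasImage f L
  image y = mk⇔ (λ Ly → contradiction Ly (L-empty y)) (λ { ((() ∷ _) , _) })

-- For `n` at most 1 every sequence is constant, and a connected complex may lack even the empty
-- simplex. From `n = 2` on, connectedness supplies an edge.
connected⇒generates : ∀ {k n} (K : Complex n) → 2 ≤ n ⊎ Simplex K ⊥ → Connected K →
                      Generates K (NC (2 ℕ.+ k) n)
connected⇒generates {n = 0} K (inj₂ K-⊥) _ =
  generates-empty K _ (λ y ¬const → ¬const (zero , λ ())) K-⊥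
connected⇒generates {n = 1} K (inj₁ (s≤s ())) _
connected⇒generates {n = 1} K (inj₂ K-⊥) _ =
  generates-empty K _ (λ y ¬const → ¬const (lookup y zero , λ { zero → refl })) K-⊥
connected⇒generates {n = suc (suc _)} K _ conn = tree-generates (rootedTree K conn)

-- If no simplex meets both I₀ and its complement, then the outputs in I₀ and
-- those in the complement depend on disjoint sets of inputs, so the image
-- contains with 0 on I₀, 1 off I₀ and 1 on I₀, 0 off I₀ also the constant 0.
generates⇒connected : ∀ {k n} (K : Complex n) → Generates K (NC (2 ℕ.+ k) n) → Connected K
generates⇒connected {k} {n} K (b , m , f , image , f⊑K) (I₀ , (u , u∈) , (v , v∈∁) , split) =
  Equivalence.from (image (f z)) (z , refl) (zero , constant)
  where
  a = 2 ℕ.+ k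

  v∉ : v ∉ I₀
  v∉ = x∈∁p⇒x∉p v∈∁

  two-valued : Fin a → Fin a → a ^ˢ n
  two-valued c d = tabulate λ i → if does (i ∈? I₀) then c else d

  on : ∀ {c d i} → i ∈ I₀ → lookup (two-valued c d) i ≡ c
  on {c} {d} {i} i∈
    rewrite lookup∘tabulate (λ i → if does (i ∈? I₀) then c else d) i
          | dec-true (i ∈? I₀) i∈ = refl

  off : ∀ {c d i} → i ∉ I₀ → lookup (two-valued c d) i ≡ d
  off {c} {d} {i} i∉
    rewrite lookup∘tabulate (λ i → if does (i ∈? I₀) then c else d) i
          | dec-false (i ∈? I₀) i∉ = refl

  preimage : ∀ c d → c ≢ d → ∃[ x ] f x ≡ two-valued c d
  preimage c d c≢d = Equivalence.to (image (two-valued c d)) λ (e , const) →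
    c≢d (trans (trans (sym (on u∈)) (const u)) (sym (trans (sym (off v∉)) (const v))))

  zero-one : ∃[ x ] f x ≡ two-valued zero (suc zero)
  zero-one = preimage zero (suc zero) λ ()

  one-zero : ∃[ y ] f y ≡ two-valued (suc zero) zero
  one-zero = preimage (suc zero) zero λ ()

  x y z : b ^ˢ m
  x = proj₁ zero-one
  y = proj₁ one-zero

  relevant? : ∀ j → Dec (∃[ i ] (i ∈ I₀ × j ∈ 𝒲 f i))
  relevant? j = any? λ i → (i ∈? I₀) ×-dec (j ∈? 𝒲 f i)

  -- Inputs seen from `I₀` are taken from `x`, all others from `y`.
  merge : Fin m → Fin b
  merge j = if does (relevant? j) then lookup x j else lookup y j

  z = tabulate merge

  z≈x : ∀ {i} → i ∈ I₀ → AgreeOn (𝒲 f i) z x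
  z≈x {i} i∈ j j∈ rewrite lookup∘tabulate merge j | dec-true (relevant? j) (i , i∈ , j∈) = refl

  -- A shared input would make the pair of `i` and `i′` a simplex of `K` meeting both sides.
  disjoint : ∀ {i i′ j} → i ∈ I₀ → i′ ∉ I₀ → j ∈ 𝒲 f i → ¬ j ∈ 𝒲 f i′
  disjoint {i} {i′} {j} i∈ i′∉ j∈ j∈′ with split (⁅ i ⁆ ∪ ⁅ i′ ⁆) (f⊑K _ (j , common))
    where
    common : ∀ l → l ∈ ⁅ i ⁆ ∪ ⁅ i′ ⁆ → j ∈ 𝒲 f l
    common l l∈ with ∈⁅u⁆∪⁅v⁆⁻ l∈
    ... | inj₁ refl = j∈
    ... | inj₂ refl = j∈′
  ... | inj₁ ⊆I₀  = i′∉ (⊆I₀ v∈⁅u⁆∪⁅v⁆)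
  ... | inj₂ ⊆∁I₀ = x∈∁p⇒x∉p (⊆∁I₀ u∈⁅u⁆∪⁅v⁆) i∈

  z≈y : ∀ {i} → i ∉ I₀ → AgreeOn (𝒲 f i) z y
  z≈y {i} i∉ j j∈
    rewrite lookup∘tabulate merge j
          | dec-false (relevant? j) (λ (_ , i′∈ , j∈′) → disjoint i′∈ i∉ j∈′ j∈) = refl

  constant : ∀ i → lookup (f z) i ≡ zero
  constant i with i ∈? I₀
  ... | yes i∈ = trans (𝒲-determines f i z x (z≈x i∈))
                   (trans (cong (λ w → lookup w i) (proj₂ zero-one)) (on i∈))
  ... | no  i∉ = trans (𝒲-determines f i z y (z≈y i∉))
                   (trans (cong (λ w → lookup w i) (proj₂ one-zero)) (off i∉))

-- Simple paths and cycles

-- The list holds the vertices after the first, so its length is the number of edges.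
data Path {n} (R : Fin n → Fin n → Set) (x : Fin n) : Fin n → List (Fin n) → Set where
  []  : Path R x x []
  _∷_ : ∀ {y z ws} → R x y → Path R y z ws → Path R x z (y ∷ ws)

module _ {n} {R : Fin n → Fin n → Set} where

  close : ∀ {x z t ws} → Path R x z ws → R z t → Linked R (x ∷ ws ++ [ t ])
  close []      r = r ∷ [-]
  close (s ∷ p) r = s ∷ close p r

  unclose : ∀ {x t} ws → Linked R (x ∷ ws ++ [ t ]) → ∃[ z ] (Path R x z ws × R z t)
  unclose []       (r ∷ [-]) = _ , [] , r
  unclose (w ∷ ws) (r ∷ l) with unclose ws l
  ... | z , p , s = z , r ∷ p , s

  last∈ : ∀ {x z ws} → Path R x z ws → z ∈ˡ x ∷ ws
  last∈ []      = here refl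
  last∈ (_ ∷ p) = there (last∈ p)

  suffix : ∀ {x y z ws} → y ∈ˡ x ∷ ws → Path R x z ws → Unique (x ∷ ws) →
           ∃[ ws′ ] (Path R y z ws′ × Unique (y ∷ ws′))
  suffix (here refl) p       u       = _ , p , u
  suffix (there y∈)  (_ ∷ p) (_ ∷ u) = suffix y∈ p u

  -- Loop erasure: if the new first vertex already occurs, only the part of the path from that
  -- occurrence on is kept.
  simplePath : ∀ {x z} → Star R x z → ∃[ ws ] (Path R x z ws × Unique (x ∷ ws))
  simplePath ε = [] , [] , [] ∷ []
  simplePath {x} (_◅_ {j = y} r s) with simplePath s
  ... | ws , p , u with Any.any? (x ≟_) (y ∷ ws)
  ... | yes x∈ = suffix x∈ p u
  ... | no  x∉ = y ∷ ws , r ∷ p , ¬Any⇒All¬ _ x∉ ∷ u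

-- Rooted trees are trees

module _ {n} {K : Complex n} (T : RootedTree K) where
  open RootedTree T

  unique-parent : ∀ {u v w} → Child u w → Child v w → u ≡ v
  unique-parent (_ , refl) (_ , refl) = refl

  ∉-tail : ∀ {x : Fin n} {ws} → Unique (x ∷ ws) → ¬ x ∈ˡ ws
  ∉-tail (x∉ ∷ _) x∈ = All.lookup x∉ x∈ refl

  -- After a step down from `x` to `y`, the only way up from `y` leads back to `x`, so a simple path
  -- goes on downwards and reaches each vertex from its parent.
  simple-descent : ∀ {x y z ws} → Child x y → Path Adjacent y z ws → Unique (x ∷ y ∷ ws) →
                   rank x < rank z × (z ≡ y ⊎ parent z ∈ˡ y ∷ ws)
  simple-descent c [] _ = rank-child c , inj₁ refl
  simple-descent c (inj₁ d ∷ p) (x∉ ∷ u) with simple-descent d p u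
  ... | y<z , inj₁ refl = <-trans (rank-child c) y<z , inj₂ (here (proj₂ d))
  ... | y<z , inj₂ ∈    = <-trans (rank-child c) y<z , inj₂ (there ∈)
  simple-descent c (inj₂ d ∷ p) u =
    contradiction (there (here (unique-parent c d))) (∉-tail u)

  -- A simple path climbs, then descends: if it descends at all it passes through the parent of `z`,
  -- otherwise the rank never grows.
  simple-path : ∀ {x z ws} → Path Adjacent x z ws → Unique (x ∷ ws) →
                parent z ∈ˡ x ∷ ws ⊎ rank z ≤ rank x
  simple-path [] _ = inj₂ ≤-refl
  simple-path (inj₁ c ∷ p) u with simple-descent c p u
  ... | _ , inj₁ refl = inj₁ (here (proj₂ c))
  ... | _ , inj₂ ∈    = inj₁ (there ∈)
  simple-path (inj₂ c ∷ p) (_ ∷ u) with simple-path p u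
  ... | inj₁ ∈   = inj₁ (there ∈)
  ... | inj₂ z≤y = inj₂ (≤-trans z≤y (<⇒≤ (rank-child c)))

  -- If the ends were adjacent, one would be the parent of the other. This contradicts either the
  -- ranks along the path or its visiting no vertex twice.
  no-chord : ∀ {x y y′ z ws} → Path Adjacent x z (y ∷ y′ ∷ ws) → Unique (x ∷ y ∷ y′ ∷ ws) →
             ¬ Adjacent z x
  no-chord (inj₁ c ∷ p) u adj with simple-descent c p u | adj
  ... | x<z , _      | inj₁ d          = <-asym x<z (rank-child d)
  ... | _   , inj₂ ∈ | inj₂ (_ , refl) = ∉-tail u ∈
  no-chord (inj₁ c ∷ (_ ∷ p)) (_ ∷ u′) adj | _ , inj₁ refl | inj₂ _ = ∉-tail u′ (last∈ p)
  no-chord (inj₂ c ∷ (_ ∷ p)) (_ ∷ u′) (inj₁ d) with refl ← unique-parent c d =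
    ∉-tail u′ (last∈ p)
  no-chord (inj₂ c ∷ p) u@(_ ∷ u′) (inj₂ d) with simple-path p u′
  ... | inj₁ ∈ with refl ← proj₂ d = ∉-tail u ∈
  ... | inj₂ z≤y = <⇒≱ (<-trans (rank-child c) (rank-child d)) z≤y

  treeGraph : Graph n
  treeGraph = record { Adj = Adjacent ; symm = swap ; irrefl = adjacent-irrefl }

  treeGraph-isTree : IsTree treeGraph
  treeGraph-isTree = (λ u v → star-to-root u ◅◅ star-from-root v) , acyclic
    where
    acyclic : ¬ HasCycle treeGraph
    acyclic (v , []          , ()     , _)
    acyclic (v , _ ∷ []      , s≤s () , _)
    acyclic (v , vs@(_ ∷ _ ∷ _) , _ , u , l) with unclose vs l
    ... | z , p , adj = no-chord p u adj

  -- Stated through the parent map, which makes simplices decidable; `simplex-of-tree` recovers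
  -- vertices and edges.
  treeComplex : Complex n
  treeComplex = record
    { Simplex  = λ S → ∃[ v ] S ⊆ ⁅ v ⁆ ∪ ⁅ parent v ⁆
    ; simplex? = λ S → any? λ v → S ⊆? (⁅ v ⁆ ∪ ⁅ parent v ⁆)
    ; closed   = λ { S⊆T (v , T⊆) → v , ⊆-trans S⊆T T⊆ }
    }

  treeComplex-⊑ : treeComplex ⊑ K
  treeComplex-⊑ S (v , S⊆) = closed K S⊆ (edge v)

  rootedTree-treeComplex : RootedTree treeComplex
  rootedTree-treeComplex = record
    { root = root ; parent = parent ; rank = rank ; parent-root = parent-root
    ; rank-parent = rank-parent ; edge = λ v → v , ⊆-refl }

  simplex-of-tree : ∀ {S} → Simplex treeComplex S → S ≡ ⊥ ⊎ IsVertexOrEdge treeGraph S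
  simplex-of-tree {S} (v , S⊆) with v ∈? S | parent v ∈? S
  ... | yes v∈ | yes p∈ with v ≟ root
  ...   | no  v≢r  = inj₂ (inj₂ (v , parent v , inj₂ (v≢r , refl) , ⊆-antisym S⊆ (⁅u⁆∪⁅v⁆⊆ v∈ p∈)))
  -- At the root the parent edge degenerates to a single vertex.
  ...   | yes refl = inj₂ (inj₁ (v , ⊆-antisym sub (⁅u⁆⊆ v∈)))
    where
    sub : S ⊆ ⁅ v ⁆
    sub w∈ with ∈⁅u⁆∪⁅v⁆⁻ (S⊆ w∈)
    ... | inj₁ refl = x∈⁅x⁆ v
    ... | inj₂ refl = subst (_∈ ⁅ v ⁆) (sym parent-root) (x∈⁅x⁆ v)
  simplex-of-tree {S} (v , S⊆) | yes v∈ | no p∉ = inj₂ (inj₁ (v , ⊆-antisym sub (⁅u⁆⊆ v∈)))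
    where
    sub : S ⊆ ⁅ v ⁆
    sub w∈ with ∈⁅u⁆∪⁅v⁆⁻ (S⊆ w∈)
    ... | inj₁ refl = x∈⁅x⁆ v
    ... | inj₂ refl = contradiction w∈ p∉
  simplex-of-tree {S} (v , S⊆) | no v∉ | yes p∈ =
    inj₂ (inj₁ (parent v , ⊆-antisym sub (⁅u⁆⊆ p∈)))
    where
    sub : S ⊆ ⁅ parent v ⁆
    sub w∈ with ∈⁅u⁆∪⁅v⁆⁻ (S⊆ w∈)
    ... | inj₁ refl = contradiction w∈ v∉
    ... | inj₂ refl = x∈⁅x⁆ (parent v)
  simplex-of-tree {S} (v , S⊆) | no v∉ | no p∉ = inj₁ (⊆-antisym sub (⊆-min S))
    where
    sub : S ⊆ ⊥
    sub w∈ with ∈⁅u⁆∪⁅v⁆⁻ (S⊆ w∈)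
    ... | inj₁ refl = contradiction w∈ v∉
    ... | inj₂ refl = contradiction w∈ p∉

  vertexOrEdge-simplex : ∀ {S} → S ≡ ⊥ ⊎ IsVertexOrEdge treeGraph S → Simplex K S
  vertexOrEdge-simplex (inj₁ refl)                             = closed K (⊆-min _) (edge root)
  vertexOrEdge-simplex (inj₂ (inj₁ (v , refl)))                = closed K (⁅u⁆⊆ u∈⁅u⁆∪⁅v⁆) (edge v)
  vertexOrEdge-simplex (inj₂ (inj₂ (_ , _ , adj , refl))) = adjacent-simplex adj

  isSpanningTree : K ⊑ treeComplex → IsSpanningTree K
  isSpanningTree K⊑ = treeGraph , treeGraph-isTree , λ S →
    mk⇔ (simplex-of-tree ∘ K⊑ S) vertexOrEdge-simplex

-- Minimal generating complexes and spanning trees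

minimal⇒spanningTree : ∀ {k n} (K : Complex (2 ℕ.+ n)) →
  IsMinimalGenerating K (NC (2 ℕ.+ k) (2 ℕ.+ n)) → IsSpanningTree K
-- The spanning tree inside `K` already generates, so by minimality it cannot be strictly smaller
-- than `K`.
minimal⇒spanningTree K (gen , minimal) = isSpanningTree T λ S K-S →
  decidable-stable (simplex? K′ S) λ ¬K′-S →
    minimal K′ (treeComplex-⊑ T , λ K⊑K′ → ¬K′-S (K⊑K′ S K-S))
      (tree-generates (rootedTree-treeComplex T))
  where
  T  = rootedTree K (generates⇒connected K gen)
  K′ = treeComplex T

module _ {n} {K : Complex n} (K-tree : IsSpanningTree K) where

  private
    G           = proj₁ K-tree
    G-connected = proj₁ (proj₁ (proj₂ K-tree))
    G-acyclic   = proj₂ (proj₁ (proj₂ K-tree))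
    simplices   = proj₂ (proj₂ K-tree)

  adj⇒simplex : ∀ {u v} → Adj G u v → Simplex K (⁅ u ⁆ ∪ ⁅ v ⁆)
  adj⇒simplex adj = Equivalence.from (simplices _) (inj₂ (inj₂ (_ , _ , adj , refl)))

  simplex⇒adj : ∀ {u v} → u ≢ v → Simplex K (⁅ u ⁆ ∪ ⁅ v ⁆) → Adj G u v
  simplex⇒adj {u} {v} u≢v K-uv with Equivalence.to (simplices _) K-uv
  ... | inj₁ eq = contradiction (subst (u ∈_) eq u∈⁅u⁆∪⁅v⁆) ∉⊥
  ... | inj₂ (inj₁ (w , eq)) = contradiction
    (trans (x∈⁅y⁆⇒x≡y w (subst (u ∈_) eq u∈⁅u⁆∪⁅v⁆))
           (sym (x∈⁅y⁆⇒x≡y w (subst (v ∈_) eq v∈⁅u⁆∪⁅v⁆)))) u≢v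
  ... | inj₂ (inj₂ (u′ , v′ , adj , eq))
    with ∈⁅u⁆∪⁅v⁆⁻ (subst (u ∈_) eq u∈⁅u⁆∪⁅v⁆) | ∈⁅u⁆∪⁅v⁆⁻ (subst (v ∈_) eq v∈⁅u⁆∪⁅v⁆)
  ... | inj₁ refl | inj₁ refl = contradiction refl u≢v
  ... | inj₁ refl | inj₂ refl = adj
  ... | inj₂ refl | inj₁ refl = symm G adj
  ... | inj₂ refl | inj₂ refl = contradiction refl u≢v

  -- A walk in `G` cannot leave `I₀`, because each of its edges is a simplex.
  spanningTree-connected : Connected K
  spanningTree-connected (I₀ , (u , u∈) , (v , v∈∁) , split) =
    x∈∁p⇒x∉p v∈∁ (stays (G-connected u v) u∈)
    where
    stays : ∀ {x y} → Star (Adj G) x y → x ∈ I₀ → y ∈ I₀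
    stays ε x∈ = x∈
    stays (adj ◅ s) x∈ with split _ (adj⇒simplex adj)
    ... | inj₁ ⊆I₀  = stays s (⊆I₀ v∈⁅u⁆∪⁅v⁆)
    ... | inj₂ ⊆∁I₀ = contradiction x∈ (x∈∁p⇒x∉p (⊆∁I₀ u∈⁅u⁆∪⁅v⁆))

  -- If an edge of `G` were missing from `T`, the simple path of `T` between its ends would run
  -- inside `G` and close up with that edge to a cycle.
  spanningTree-minimal : ∀ {K′} → K′ ⊑ K → RootedTree K′ → K ⊑ K′
  spanningTree-minimal {K′} K′⊑K T S K-S with Equivalence.to (simplices S) K-S
  ... | inj₁ S≡⊥               = vertexOrEdge-simplex T (inj₁ S≡⊥)
  ... | inj₂ (inj₁ vertex)      = vertexOrEdge-simplex T (inj₂ (inj₁ vertex))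
  ... | inj₂ (inj₂ (u , v , adj , refl)) with RootedTree.adjacent? T u v
  ...   | yes adj′ = RootedTree.adjacent-simplex T adj′
  ...   | no  ¬adj′ with simplePath (proj₁ (treeGraph-isTree T) u v)
  ...     | ws , p , unique =
    contradiction (u , ws , long p ¬adj′ adj , unique , close (mapPath p) (symm G adj)) G-acyclic
    where
    open RootedTree T using (Adjacent; adjacent-simplex; adjacent-irrefl)

    tree-adj : ∀ {x y} → Adjacent x y → Adj G x y
    tree-adj {x} {y} a = simplex⇒adj (λ { refl → adjacent-irrefl a }) (K′⊑K _ (adjacent-simplex a))

    mapPath : ∀ {x z ws} → Path Adjacent x z ws → Path (Adj G) x z ws
    mapPath []      = []
    mapPath (a ∷ p) = tree-adj a ∷ mapPath p

    -- Distinct ends that are not adjacent in `T` force at least two edges, hence a cycle of length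
    -- at least 3.
    long : ∀ {x z ws} → Path Adjacent x z ws → ¬ Adjacent x z → Adj G x z → 2 ≤ length ws
    long []            _  a = contradiction a (irrefl G)
    long (a ∷ [])      ¬a _ = contradiction a ¬a
    long (_ ∷ (_ ∷ _)) _  _ = s≤s (s≤s z≤n)

spanningTree⇒minimal : ∀ {k n} (K : Complex (2 ℕ.+ n)) →
  IsSpanningTree K → IsMinimalGenerating K (NC (2 ℕ.+ k) (2 ℕ.+ n))
spanningTree⇒minimal K T =
  tree-generates (rootedTree K (spanningTree-connected {K = K} T)) ,
  λ K′ (K′⊑K , K⋢K′) gen →
    K⋢K′ (spanningTree-minimal {K = K} T K′⊑K (rootedTree K′ (generates⇒connected K′ gen)))

-- Without vertices only the empty set can be a simplex. `NC` is empty, so a generating function has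
-- empty domain; hence J is non-empty and the empty set is a simplex.
minimal⇔spanningTree₀ : ∀ {k} (K : Complex 0) →
  IsMinimalGenerating K (NC (2 ℕ.+ k) 0) ⇔ IsSpanningTree K
minimal⇔spanningTree₀ K = mk⇔ to from
  where
  generates⇒⊥ : ∀ {k} K → Generates K (NC (2 ℕ.+ k) 0) → Simplex K ⊥
  generates⇒⊥ K (_ , zero  , _ , image , _)   =
    contradiction (zero , λ ()) (Equivalence.from (image []) ([] , lookup-ext _ [] λ ()))
  generates⇒⊥ K (_ , suc m , _ , _     , f⊑K) = f⊑K ⊥ (zero , λ ())

  to : _ → IsSpanningTree K
  to (gen , _) =
    record { Adj = λ () ; symm = λ { {()} } ; irrefl = λ { {()} } } , ((λ ()) , λ ()) ,
    λ { [] → mk⇔ (λ _ → inj₁ refl) (λ _ → generates⇒⊥ K gen) }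

  from : IsSpanningTree K → _
  from (_ , _ , simplices) =
    connected⇒generates K (inj₂ (Equivalence.from (simplices []) (inj₁ refl))) (λ ()) ,
    λ { K′ (_ , K⋢K′) gen → K⋢K′ λ { [] _ → generates⇒⊥ K′ gen } }

-- For `n` at most 1 the complex with no simplices is connected but does not generate the empty
-- language. For `n = 1` the minimal complex contains only the empty set, whereas the spanning tree
-- also contains the vertex.
proposition3p3 : ∀ (a n : ℕ) → 2 ≤ a →
    (∀ (K : Complex n) → 2 ≤ n ⊎ Simplex K ⊥ → Generates K (NC a n) ⇔ Connected K)
    × (n ≢ 1 → ∀ (K : Complex n) → IsMinimalGenerating K (NC a n) ⇔ IsSpanningTree K)
proposition3p3 (suc (suc k)) n (s≤s (s≤s _)) =
  (λ K h → mk⇔ (generates⇒connected {k} K) (connected⇒generates {k} K h)) , minimal⇔tree n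
  where
  minimal⇔tree : ∀ n → n ≢ 1 → (K : Complex n) →
                 IsMinimalGenerating K (NC (2 ℕ.+ k) n) ⇔ IsSpanningTree K
  minimal⇔tree 0             _   K = minimal⇔spanningTree₀ {k} K
  minimal⇔tree 1             1≢1 K = contradiction refl 1≢1
  minimal⇔tree (suc (suc n)) _   K =
    mk⇔ (minimal⇒spanningTree {k} K) (spanningTree⇒minimal {k} K)
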